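{- Let $T$ be an h-inductive theory in a first-order language $L$. Then $T$ is a positive Robinson theory if and only if the class of substructures of pc models of $T$ has the amalgamation property.
   Context: Let $L$ be a first-order language with equality. A positive formula is one obtained from atomic formulas (including falsity $\bot$) using $\exists,\vee,\wedge$. An h-inductive sentence is a finite conjunction of sentences $\forall\bar x(\exists\bar y\,\varphi(\bar x,\bar y)\rightarrow\exists\bar z\,\psi(\bar x,\bar z))$ with $\varphi,\psi$ quantifier-free positive. An h-inductive theory is a theory axiomatized by h-inductive sentences. A homomorphism $f:A\to B$ of $L$-structures is a map such that $A\models\phi(\bar a)$ implies $B\models\phi(f(\bar a))$ for every atomic $\phi$ and tuple $\bar a$ of $A$; it is an immersion if $\bar a$ and $f(\bar a)$ satisfy the same positive formulas for every tuple $\bar a$ of $A$. A model $M$ of $T$ is a pc model of $T$ if every homomorphism from $M$ into a model of $T$ is an immersion. For a tuple $\bar a$ of a structure $A$, $D_A(\bar a)$ is the set of quantifier-free positive formulas satisfied by $\bar a$ in $A$; for a tuple $\bar a$ of a pc model $A$ of $T$, $tp(\bar a)$ is the set of all positive formulas satisfied by $\bar a$ in $A$. $T$ is positive Robinson if for all pc models $A,B$ of $T$ and all nonempty finite tuples $\bar a$ of $A$ and $\bar b$ of $B$ of the same length, $D_A(\bar a)\subseteq D_B(\bar b)$ implies $tp(\bar a)=tp(\bar b)$. A class $\Gamma$ of $L$-structures has the amalgamation property if for all $A,B,C\in\Gamma$ and homomorphisms $f:A\to B$, $g:A\to C$ there are $D\in\Gamma$ and homomorphisms $g':B\to D$, $f':C\to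 D$ with $g'\circ f=f'\circ g$. Structures are nonempty, and classes of structures are taken up to isomorphism. -}

module Defs where

open import Axiom.ExcludedMiddle using (ExcludedMiddle)
open import Axiom.Extensionality.Propositional using (Extensionality)
open import Data.Empty.Polymorphic using (⊥)
open import Data.Fin using (Fin)
open import Data.List using (List)
open import Data.List.Relation.Unary.All using (All)
open import Data.Nat using (ℕ; suc; _+_)
open import Data.Product using (Σ; Σ-syntax; ∃; ∃-syntax; _×_; _,_; proj₁; proj₂)
open import Data.Sum using (_⊎_)
open import Data.Vec.Functional using (Vector; _∷_; _++_; map)
open import Function using (_⇔_)
open import Level using (Level; Setω) renaming (suc to lsuc)
open import Relation.Binary using (Setoid)
open import Relation.Unary using (Pred; _∈_; _⊆_; _≐_)

-- The classical set theory in which model theory is carried out, as axioms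
-- about Agda's universes.  ExcludedMiddle decides every type, not only
-- propositions, so it also yields choice functions (¬ ¬ A → A for all A).
-- Extensionality is needed to make a choice depend only on the extension of
-- a subset (a Bool-valued function), as in the usual proof of Zorn's lemma.
record ClassicalSetTheory : Setω where
  field
    excludedMiddle : ∀ {a} → ExcludedMiddle a
    extensionality : ∀ {a b} → Extensionality a b

record Language (ℓ : Level) : Set (lsuc ℓ) where
  field
    Fun      : Set ℓ
    Rel      : Set ℓ
    funArity : Fun → ℕ
    relArity : Rel → ℕ

module PositiveLogic {ℓ : Level} (L : Language ℓ) where

  open Language L

  data Term (n : ℕ) : Set ℓ where
    var : Fin n → Term n
    fun : (f : Fun) → Vector (Term n) (funArity f) → Term n

  data Atomic (n : ℕ) : Set ℓ where
    falsity : Atomic n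
    _≐ᵗ_    : Term n → Term n → Atomic n
    rel     : (R : Rel) → Vector (Term n) (relArity R) → Atomic n

  -- Positive formulas in n free variables; the quantifier binds variable zero.
  data Formula : ℕ → Set ℓ where
    atom    : ∀ {n} → Atomic n → Formula n
    _∧_ _∨_ : ∀ {n} → Formula n → Formula n → Formula n
    exists  : ∀ {n} → Formula (suc n) → Formula n

  data QuantifierFree {n : ℕ} : Formula n → Set ℓ where
    atom : (α : Atomic n) → QuantifierFree (atom α)
    _∧_  : ∀ {φ ψ} → QuantifierFree φ → QuantifierFree ψ → QuantifierFree (φ ∧ ψ)
    _∨_  : ∀ {φ ψ} → QuantifierFree φ → QuantifierFree ψ → QuantifierFree (φ ∨ ψ)

  -- ∀ x̄ (∃ ȳ φ(x̄,ȳ) → ∃ z̄ ψ(x̄,z̄)), where the first #x variables of φ and of ψ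
  -- are x̄.
  record HInductiveImplication : Set ℓ where
    field
      #x #y #z : ℕ
      φ        : Formula (#x + #y)
      ψ        : Formula (#x + #z)
      φ-qf     : QuantifierFree φ
      ψ-qf     : QuantifierFree ψ

  -- A list stands for the conjunction of its members.
  HInductiveSentence : Set ℓ
  HInductiveSentence = List HInductiveImplication

  -- An h-inductive theory, given by a set of h-inductive axioms.
  HInductiveTheory : Set (lsuc ℓ)
  HInductiveTheory = Pred HInductiveSentence ℓ

  -- The setoid equality interprets the equality symbol.
  record Structure : Set (lsuc ℓ) where
    field
      setoid    : Setoid ℓ ℓ
    open Setoid setoid public
    field
      inhabited : Carrier
      ⟦fun⟧     : (f : Fun) → Vector Carrier (funArity f) → Carrier
      ⟦rel⟧     : (R : Rel) → Vector Carrier (relArity R) → Set ℓ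
      fun-cong  : ∀ f {a b} → (∀ i → a i ≈ b i) → ⟦fun⟧ f a ≈ ⟦fun⟧ f b
      rel-resp  : ∀ R {a b} → (∀ i → a i ≈ b i) → ⟦rel⟧ R a → ⟦rel⟧ R b

  open Structure using (Carrier)

  eval : (A : Structure) → ∀ {n} → Vector (Carrier A) n → Term n → Carrier A
  eval A a (var i)    = a i
  eval A a (fun f ts) = Structure.⟦fun⟧ A f (λ i → eval A a (ts i))

  infix 4 _⊨ᵃ_[_] _⊨_[_]

  _⊨ᵃ_[_] : (A : Structure) → ∀ {n} → Atomic n → Vector (Carrier A) n → Set ℓ
  A ⊨ᵃ falsity  [ a ] = ⊥
  A ⊨ᵃ s ≐ᵗ t   [ a ] = Structure._≈_ A (eval A a s) (eval A a t)
  A ⊨ᵃ rel R ts [ a ] = Structure.⟦rel⟧ A R (λ i → eval A a (ts i))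

  _⊨_[_] : (A : Structure) → ∀ {n} → Formula n → Vector (Carrier A) n → Set ℓ
  A ⊨ atom α   [ a ] = A ⊨ᵃ α [ a ]
  A ⊨ φ ∧ ψ    [ a ] = (A ⊨ φ [ a ]) × (A ⊨ ψ [ a ])
  A ⊨ φ ∨ ψ    [ a ] = (A ⊨ φ [ a ]) ⊎ (A ⊨ ψ [ a ])
  A ⊨ exists φ [ a ] = ∃[ x ] (A ⊨ φ [ x ∷ a ])

  Satisfies : Structure → HInductiveImplication → Set ℓ
  Satisfies A σ =
    (x : Vector (Carrier A) #x) →
    (∃[ y ] (A ⊨ φ [ _++_ {m = #x} {n = #y} x y ])) →
    (∃[ z ] (A ⊨ ψ [ _++_ {m = #x} {n = #z} x z ]))
    where open HInductiveImplication σ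

  IsModel : HInductiveTheory → Structure → Set ℓ
  IsModel T A = ∀ σ → σ ∈ T → All (Satisfies A) σ

  record Hom (A B : Structure) : Set ℓ where
    field
      to        : Carrier A → Carrier B
      preserves : ∀ {n} (α : Atomic n) (a : Vector (Carrier A) n) →
                  A ⊨ᵃ α [ a ] → B ⊨ᵃ α [ map to a ]

  open Hom using (to)

  IsImmersion : ∀ {A B} → Hom A B → Set ℓ
  IsImmersion {A} {B} h =
    ∀ {n} (a : Vector (Carrier A) n) (φ : Formula n) →
    A ⊨ φ [ a ] ⇔ B ⊨ φ [ map (to h) a ]

  IsPC : HInductiveTheory → Structure → Set (lsuc ℓ)
  IsPC T M = IsModel T M × (∀ N → IsModel T N → (h : Hom M N) → IsImmersion h)

  D : (A : Structure) → ∀ {n} → Vector (Carrier A) n → Pred (Formula n) ℓ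
  D A a φ = QuantifierFree φ × (A ⊨ φ [ a ])

  tp : (A : Structure) → ∀ {n} → Vector (Carrier A) n → Pred (Formula n) ℓ
  tp A a φ = A ⊨ φ [ a ]

  IsPositiveRobinson : HInductiveTheory → Set (lsuc ℓ)
  IsPositiveRobinson T =
    ∀ A B → IsPC T A → IsPC T B →
    ∀ {n} (a : Vector (Carrier A) (suc n)) (b : Vector (Carrier B) (suc n)) →
    D A a ⊆ D B b → tp A a ≐ tp B b

  record Substructure (M : Structure) : Set (lsuc ℓ) where
    open Structure M using (_≈_; ⟦fun⟧)
    field
      Member    : Pred (Carrier M) ℓ
      resp      : ∀ {x y} → x ≈ y → x ∈ Member → y ∈ Member
      inhabited : ∃ Member
      closed    : ∀ f (a : Vector (Carrier M) (funArity f)) →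
                  (∀ i → a i ∈ Member) → ⟦fun⟧ f a ∈ Member

  induced : (M : Structure) → Substructure M → Structure
  induced M S = record
    { setoid    = record
      { Carrier       = ∃ Member
      ; _≈_           = λ x y → proj₁ x ≈ proj₁ y
      ; isEquivalence = record { refl = refl ; sym = sym ; trans = trans }
      }
    ; inhabited = inhabited
    ; ⟦fun⟧     = λ f a → ⟦fun⟧ f (map proj₁ a) , closed f (map proj₁ a) (λ i → proj₂ (a i))
    ; ⟦rel⟧     = λ R a → ⟦rel⟧ R (map proj₁ a)
    ; fun-cong  = λ f → fun-cong f
    ; rel-resp  = λ R → rel-resp R
    }
    where
    open Structure M hiding (inhabited)
    open Substructure S

  record _≅_ (A B : Structure) : Set ℓ where
    field
      forth      : Hom A B
      back       : Hom B A
      back-forth : ∀ x → Structure._≈_ A (to back (to forth x)) x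
      forth-back : ∀ y → Structure._≈_ B (to forth (to back y)) y

  SubstructuresOfPCModels : HInductiveTheory → Pred Structure (lsuc ℓ)
  SubstructuresOfPCModels T A =
    Σ[ M ∈ Structure ] (IsPC T M × (Σ[ S ∈ Substructure M ] (A ≅ induced M S)))

  HasAmalgamation : Pred Structure (lsuc ℓ) → Set (lsuc ℓ)
  HasAmalgamation Γ =
    ∀ A B C → A ∈ Γ → B ∈ Γ → C ∈ Γ → (f : Hom A B) (g : Hom A C) →
    Σ[ E ∈ Structure ] (E ∈ Γ × (Σ[ g′ ∈ Hom B E ] Σ[ f′ ∈ Hom C E ]
      (∀ x → Structure._≈_ E (to g′ (to f x)) (to f′ (to g x)))))

{-# OPTIONS --safe #-}

-- If T is positive Robinson, A ⊆ M with M pc, and f : A → B, g : A → C with B, C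
-- pc, then a tuple of A has the same positive type in M, in B (along f) and in
-- C (along g).  So finitely many positive facts about B, C and A are realised
-- in M itself, and by compactness B and C amalgamate over A in a pc model.
-- Conversely, D(a) ⊆ D(b) says that a ↦ b extends to a homomorphism on the
-- substructure generated by a; amalgamating it with the inclusion embeds both
-- pc models into a common model of T, and these homomorphisms are immersions.
module Submission where

open import Defs
open import Data.Bool using (Bool; true; false; T)
open import Data.Bool.Properties using (T-irrelevant)
open import Data.Empty using (⊥-elim)
open import Data.Empty.Polymorphic using (⊥)
open import Data.Fin using (Fin; zero; suc; splitAt; _↑ˡ_; _↑ʳ_)
open import Data.List as List using (List)
open import Data.List.Membership.Propositional using () renaming (_∈_ to _∈ˡ_)
open import Data.List.Relation.Unary.All as All using (All)
open import Data.List.Relation.Unary.All.Properties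
  using (anti-mono; map⁺; tabulate⁺; tabulate⁻; ++⁺; ++⁻ˡ; ++⁻ʳ)
open import Data.List.Relation.Unary.Any using (here; there)
open import Data.Nat using (ℕ; zero; suc; _+_)
open import Data.Product using (Σ-syntax; ∃; ∃-syntax; _×_; _,_; proj₁; proj₂)
open import Data.Sum as Sum using (_⊎_; inj₁; inj₂; [_,_])
open import Data.Sum.Properties using ([,]-∘)
open import Data.Unit.Polymorphic using (⊤; tt)
open import Data.Vec.Functional using (Vector; []; _∷_; _++_; map)
open import Data.Vec.Functional.Properties using (lookup-++ˡ; lookup-++ʳ)
open import Function using (_⇔_; mk⇔; Equivalence; _∘_; id)
open import Level using (Level; Lift; lift; lower; _⊔_; 0ℓ) renaming (suc to lsuc)
open import Relation.Binary.PropositionalEquality using (_≡_; refl; sym; trans; cong; cong₂; subst)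
open import Relation.Nullary using (Dec; yes; no; ¬_)
open import Relation.Nullary.Decidable using (toWitness; fromWitness; isYes; decidable-stable)
open import Relation.Unary using (Pred; _∈_; _⊆_; _∪_)

-- Compactness by itself yields a model, while the amalgam must be pc, and positive logic has no
-- negation with which to complete a theory. Maximality answers both needs. When a set of sentences
-- is maximal among those whose finite parts hold in models of the theory, each sentence that it
-- omits is incompatible with one of its finite parts. So it is prime for disjunction, and the
-- structure read off from it is pc: a positive formula that becomes true along a homomorphism into
-- a model is compatible with every finite part, hence was true already. Since these sets are tested
-- against all models, which live one universe higher, subsets are coded by Boolean functions
-- throughout.

module Classical (cst : ClassicalSetTheory) where

  open ClassicalSetTheory cst

  -- Classical choice and maximal sets of finite character.

  byContradiction : ∀ {a} {A : Set a} → ¬ ¬ A → A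
  byContradiction = decidable-stable excludedMiddle

  -- Takes the decision as an argument, so that a later `with` on the same instance of excluded
  -- middle lets it compute.
  choose : ∀ {a b} {A : Set a} {B : Set b} → Dec A → (A → B) → B → B
  choose (yes a) f _ = f a
  choose (no _)  _ b = b

  -- The Teichmüller–Tukey lemma, by the Bourbaki–Witt argument: the sets
  -- reached from Base by adding single elements and taking unions form a
  -- chain, so their union is one of them and cannot be enlarged.
  module TeichmüllerTukey {s b c} {S : Set s} (Con : Pred (List S) c) (Base : Pred S b)
    (mono : ∀ {Γ Δ} → (∀ {x} → x ∈ˡ Γ → x ∈ˡ Δ) → Con Δ → Con Γ)
    (base : ∀ Γ → All Base Γ → Con Γ) where

    -- Excluded middle resizes a predicate of any level to a Boolean one. This lets the family of
    -- all tower members be the index of a single `union`, which puts `top` into the tower.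
    ⟨_⟩ : ∀ {a} {A : Set a} {p} → Pred A p → A → Bool
    ⟨ P ⟩ x = isYes (excludedMiddle {P = P x})

    into : ∀ {a} {A : Set a} {p} (P : Pred A p) {x} → P x → T (⟨ P ⟩ x)
    into _ = fromWitness

    out : ∀ {a} {A : Set a} {p} (P : Pred A p) {x} → T (⟨ P ⟩ x) → P x
    out _ = toWitness

    infix 4 _≼_

    _≼_ : (P Q : S → Bool) → Set s
    P ≼ Q = ∀ {x} → T (P x) → T (Q x)

    ≼-antisym : ∀ {P Q} → P ≼ Q → Q ≼ P → P ≡ Q
    ≼-antisym P≼Q Q≼P = extensionality (λ x → agree P≼Q Q≼P)
      where
      agree : ∀ {p q} → (T p → T q) → (T q → T p) → p ≡ q
      agree {false} {false} _ _ = refl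
      agree {false} {true}  _ g = ⊥-elim (g _)
      agree {true}  {false} f _ = ⊥-elim (f _)
      agree {true}  {true}  _ _ = refl

    Consistent : Pred (S → Bool) _
    Consistent P = ∀ Γ → All (T ∘ P) Γ → Con Γ

    _▹_ : (S → Bool) → S → S → Bool
    P ▹ x = ⟨ (λ y → T (P y) ⊎ y ≡ x) ⟩

    ▹⁺ : ∀ P x {y} → T (P y) ⊎ y ≡ x → T ((P ▹ x) y)
    ▹⁺ P x = into (λ y → T (P y) ⊎ y ≡ x)

    ▹⁻ : ∀ P x {y} → T ((P ▹ x) y) → T (P y) ⊎ y ≡ x
    ▹⁻ P x = out (λ y → T (P y) ⊎ y ≡ x)

    Proper : (S → Bool) → Pred S _
    Proper P x = ¬ T (P x) × Consistent (P ▹ x)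

    next : (S → Bool) → S → Bool
    next P = choose (excludedMiddle {P = ∃ (Proper P)}) (λ (x , _) → P ▹ x) P

    next-inflates : ∀ P → P ≼ next P
    next-inflates P with excludedMiddle {P = ∃ (Proper P)}
    ... | yes (x , _) = ▹⁺ P x ∘ inj₁
    ... | no _  = λ p → p

    -- Including `Base` makes the empty union the starting point of the tower.
    ⋃ : ∀ {q} → Pred (S → Bool) q → S → Bool
    ⋃ Q = ⟨ Base ∪ (λ x → ∃[ P ] Q P × T (P x)) ⟩

    ⋃⁺ : ∀ {q} (Q : Pred (S → Bool) q) {x} → Base x ⊎ (∃[ P ] Q P × T (P x)) → T (⋃ Q x)
    ⋃⁺ Q = into (Base ∪ (λ x → ∃[ P ] Q P × T (P x)))

    ⋃⁻ : ∀ {q} (Q : Pred (S → Bool) q) {x} → T (⋃ Q x) → Base x ⊎ (∃[ P ] Q P × T (P x))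
    ⋃⁻ Q = out (Base ∪ (λ x → ∃[ P ] Q P × T (P x)))

    data Tower : Pred (S → Bool) (lsuc 0ℓ ⊔ s) where
      step  : ∀ {P} → Tower P → Tower (next P)
      union : (Q : (S → Bool) → Bool) → (∀ {P} → T (Q P) → Tower P) → Tower (⋃ (T ∘ Q))

    Base≼ : ∀ {P x} → Tower P → Base x → T (P x)
    Base≼ (step t)    x = next-inflates _ (Base≼ t x)
    Base≼ (union Q _) x = ⋃⁺ (T ∘ Q) (inj₁ x)

    ≼⋃ : ∀ {Q : (S → Bool) → Bool} {P} → T (Q P) → P ≼ ⋃ (T ∘ Q)
    ≼⋃ {Q} q p = ⋃⁺ (T ∘ Q) (inj₂ (_ , q , p))

    ⋃≼ : ∀ {Q : (S → Bool) → Bool} {R} → Tower R → (∀ {P} → T (Q P) → P ≼ R) → ⋃ (T ∘ Q) ≼ R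
    ⋃≼ {Q} r Q≼R x with ⋃⁻ (T ∘ Q) x
    ... | inj₁ x∈Base      = Base≼ r x∈Base
    ... | inj₂ (_ , q , p) = Q≼R q p

    -- The extreme points of the Bourbaki-Witt argument: `next` never leads from strictly below `P`
    -- to a set outside `P`.
    Extreme : Pred (S → Bool) _
    Extreme P = ∀ {R} → Tower R → R ≼ P → R ≡ P ⊎ next R ≼ P

    -- Induction on the tower of `R`. At a union, either some member already contains `next P`, or
    -- every member lies below `P` and so does their union.
    extreme-comparable : ∀ {P} → Tower P → Extreme P → ∀ {R} → Tower R → R ≼ P ⊎ next P ≼ R
    extreme-comparable p e {R} (step r) with extreme-comparable p e r
    ... | inj₂ P≼R = inj₂ (next-inflates _ ∘ P≼R)
    ... | inj₁ R≼P with e r R≼P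
    ...   | inj₁ refl = inj₂ id
    ...   | inj₂ lt   = inj₁ lt
    extreme-comparable {P} p e (union Q t)
      with excludedMiddle {P = ∃[ R ] Σ[ q ∈ T (Q R) ] next P ≼ R}
    ... | yes (_ , q , P≼R) = inj₂ (≼⋃ q ∘ P≼R)
    ... | no none           = inj₁ (⋃≼ p below)
      where
      below : ∀ {R} → T (Q R) → R ≼ P
      below q with extreme-comparable p e (t q)
      ... | inj₁ R≼P = R≼P
      ... | inj₂ P≼R = ⊥-elim (none (_ , q , P≼R))

    -- At a union, a tower set `R` that differs from it fails to contain some member; comparison
    -- with that member, extreme by induction, bounds `next R`.
    all-extreme : ∀ {P} → Tower P → Extreme P
    all-extreme (step p) r R≼ with extreme-comparable p (all-extreme p) r
    ... | inj₂ ≼R = inj₁ (≼-antisym R≼ ≼R)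
    ... | inj₁ R≼P with all-extreme p r R≼P
    ...   | inj₁ refl = inj₂ id
    ...   | inj₂ lt   = inj₂ (next-inflates _ ∘ lt)
    all-extreme (union Q t) {R} r R≼
      with excludedMiddle {P = ∃[ P ] T (Q P) × ¬ (P ≼ R)}
    ... | no none = inj₁ (≼-antisym R≼ (⋃≼ r (λ q {x} → byContradiction (λ n → none (_ , q , λ P≼R → n P≼R)))))
    ... | yes (P , q , P⋠R) with extreme-comparable (t q) (all-extreme (t q)) r
    ...   | inj₂ P≼R = ⊥-elim (P⋠R (P≼R ∘ next-inflates _))
    ...   | inj₁ R≼P with all-extreme (t q) r R≼P
    ...     | inj₁ refl = ⊥-elim (P⋠R id)
    ...     | inj₂ lt   = inj₂ (≼⋃ q ∘ lt)

    chain : ∀ {P R} → Tower P → Tower R → P ≼ R ⊎ R ≼ P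
    chain p r with extreme-comparable r (all-extreme r) p
    ... | inj₁ P≼R = inj₁ P≼R
    ... | inj₂ R≼P = inj₂ (R≼P ∘ next-inflates _)

    -- By `chain`, the finitely many members involved have a largest one. The first alternative
    -- remains when no member is involved, as for an empty family.
    finite-⋃ : ∀ (Q : (S → Bool) → Bool) → (∀ {P} → T (Q P) → Tower P) →
               ∀ Γ → All (T ∘ ⋃ (T ∘ Q)) Γ → All Base Γ ⊎ (∃[ P ] T (Q P) × All (T ∘ P) Γ)
    finite-⋃ Q t _ All.[] = inj₁ All.[]
    finite-⋃ Q t _ (x All.∷ xs) with ⋃⁻ (T ∘ Q) x | finite-⋃ Q t _ xs
    ... | inj₁ b           | inj₁ bs           = inj₁ (b All.∷ bs)
    ... | inj₁ b           | inj₂ (_ , q , ps) = inj₂ (_ , q , Base≼ (t q) b All.∷ ps)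
    ... | inj₂ (_ , q , p) | inj₁ bs           = inj₂ (_ , q , p All.∷ All.map (Base≼ (t q)) bs)
    ... | inj₂ (_ , q , p) | inj₂ (_ , q′ , ps) with chain (t q) (t q′)
    ...   | inj₁ le = inj₂ (_ , q′ , le p All.∷ ps)
    ...   | inj₂ le = inj₂ (_ , q , p All.∷ All.map le ps)

    tower-consistent : ∀ {P} → Tower P → Consistent P
    tower-consistent (step {P} p) with excludedMiddle {P = ∃ (Proper P)}
    ... | yes (_ , _ , con) = con
    ... | no _              = tower-consistent p
    tower-consistent (union Q t) Γ γ with finite-⋃ Q t Γ γ
    ... | inj₁ bs           = base Γ bs
    ... | inj₂ (_ , q , ps) = tower-consistent (t q) Γ ps

    top : S → Bool
    top = ⋃ (T ∘ ⟨ Tower ⟩)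

    top-tower : Tower top
    top-tower = union ⟨ Tower ⟩ (out Tower)

    split : ∀ {P x} Γ → All (T ∘ (P ▹ x)) Γ →
            ∃[ Δ ] All (T ∘ P) Δ × (∀ {y} → y ∈ˡ Γ → y ∈ˡ x List.∷ Δ)
    split _ All.[] = List.[] , All.[] , λ ()
    split {P} {x} (y List.∷ Γ) (p All.∷ ps) with split {P} {x} Γ ps | ▹⁻ P x p
    ... | Δ , δ , sub | inj₁ q    = y List.∷ Δ , q All.∷ δ ,
      λ { (here refl) → there (here refl) ; (there i) → insert (sub i) }
      where
      insert : ∀ {x z} → z ∈ˡ x List.∷ Δ → z ∈ˡ x List.∷ y List.∷ Δ
      insert (here e)  = here e
      insert (there i) = there (there i)
    ... | Δ , δ , sub | inj₂ refl = Δ , δ , λ { (here e) → here e ; (there i) → sub i }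

    top-maximal : ∀ x → (∀ Γ → All (T ∘ top) Γ → Con (x List.∷ Γ)) → T (top x)
    top-maximal x con = byContradiction λ x∉top →
      let x∈proper : Proper top x
          x∈proper = x∉top , λ Γ γ → let (Δ , δ , sub) = split {top} {x} Γ γ in mono sub (con Δ δ)
          -- `next` may add an element other than `x`; any new element contradicts that `top`
          -- contains every tower set.
          (y , y∉top , grows) = growth (x , x∈proper)
      in y∉top (≼⋃ {⟨ Tower ⟩} (into Tower (step top-tower)) grows)
      where
      growth : ∃ (Proper top) → ∃[ y ] ¬ T (top y) × T (next top y)
      growth e with excludedMiddle {P = ∃ (Proper top)}
      ... | yes (y , y∉top , _) = y , y∉top , ▹⁺ top y (inj₂ refl)
      ... | no ¬e               = ⊥-elim (¬e e)

    teichmüllerTukey : ∃[ P ] (Base ⊆ T ∘ P) × Consistent P ×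
      (∀ x → (∀ Γ → All (T ∘ P) Γ → Con (x List.∷ Γ)) → T (P x))
    teichmüllerTukey = top , Base≼ top-tower , tower-consistent top-tower , top-maximal

module PositiveModelTheory (cst : ClassicalSetTheory) {ℓ : Level} (L : Language ℓ) where

  open ClassicalSetTheory cst
  open Classical cst
  open Language L
  open PositiveLogic L
  open Structure using (Carrier)
  open Hom using (to; preserves)

  -- Tuples, substitution of variables and blocks of quantifiers.

  ∷-map : ∀ {a b} {A : Set a} {B : Set b} (f : A → B) x {n} (xs : Vector A n) →
          map f (x ∷ xs) ≡ f x ∷ map f xs
  ∷-map f x xs = extensionality λ { zero → refl ; (suc _) → refl }

  ++-map : ∀ {a b} {A : Set a} {B : Set b} (f : A → B) {m n} (xs : Vector A m) (ys : Vector A n) →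
           map f (xs ++ ys) ≡ map f xs ++ map f ys
  ++-map f {m} xs ys = extensionality λ i → [,]-∘ f (splitAt m i)

  ∷-++ : ∀ {a} {A : Set a} x {m n} (xs : Vector A m) (ys : Vector A n) →
         (x ∷ xs) ++ ys ≡ x ∷ (xs ++ ys)
  ∷-++ x {m} xs ys = extensionality λ { zero → refl ; (suc i) → lemma (splitAt m i) }
    where
    lemma : ∀ s → [ x ∷ xs , ys ] (Sum.map₁ suc s) ≡ [ xs , ys ] s
    lemma (inj₁ _) = refl
    lemma (inj₂ _) = refl

  ∷-head-tail : ∀ {a} {A : Set a} {n} (xs : Vector A (suc n)) → xs zero ∷ (xs ∘ suc) ≡ xs
  ∷-head-tail xs = extensionality λ { zero → refl ; (suc _) → refl }

  ++-↑ˡ : ∀ {a} {A : Set a} {m n} (xs : Vector A m) (ys : Vector A n) → (xs ++ ys) ∘ (_↑ˡ n) ≡ xs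
  ++-↑ˡ xs ys = extensionality (lookup-++ˡ xs ys)

  ++-↑ʳ : ∀ {a} {A : Set a} {m n} (xs : Vector A m) (ys : Vector A n) → (xs ++ ys) ∘ (m ↑ʳ_) ≡ ys
  ++-↑ʳ xs ys = extensionality (lookup-++ʳ xs ys)

  -- Axioms list the parameters before the quantified variables, whereas `∃*` binds an initial
  -- block; this exchange reconciles the two.
  swap : ∀ m n → Fin (m + n) → Fin (n + m)
  swap m n = (n ↑ʳ_) ++ (_↑ˡ m)

  ++-swap : ∀ {a} {A : Set a} {m n} (xs : Vector A m) (ys : Vector A n) → (ys ++ xs) ∘ swap m n ≡ xs ++ ys
  ++-swap {m = m} {n} xs ys = trans (++-map (ys ++ xs) (n ↑ʳ_) (_↑ˡ m))
    (cong₂ _++_ (++-↑ʳ ys xs) (++-↑ˡ ys xs))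

  substᵗ : ∀ {m n} → (Fin m → Term n) → Term m → Term n
  substᵗ τ (var i)    = τ i
  substᵗ τ (fun f ts) = fun f (λ i → substᵗ τ (ts i))

  substᵃ : ∀ {m n} → (Fin m → Term n) → Atomic m → Atomic n
  substᵃ τ falsity    = falsity
  substᵃ τ (s ≐ᵗ t)   = substᵗ τ s ≐ᵗ substᵗ τ t
  substᵃ τ (rel R ts) = rel R (λ i → substᵗ τ (ts i))

  rename : ∀ {m n} → (Fin m → Fin n) → Formula m → Formula n
  rename ρ (atom α)   = atom (substᵃ (var ∘ ρ) α)
  rename ρ (φ ∧ ψ)    = rename ρ φ ∧ rename ρ ψ
  rename ρ (φ ∨ ψ)    = rename ρ φ ∨ rename ρ ψ
  rename ρ (exists φ) = exists (rename (zero ∷ (suc ∘ ρ)) φ)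

  eval-subst : ∀ A {m n} (τ : Fin m → Term n) a t →
               eval A a (substᵗ τ t) ≡ eval A (λ i → eval A a (τ i)) t
  eval-subst A τ a (var i)    = refl
  eval-subst A τ a (fun f ts) =
    cong (Structure.⟦fun⟧ A f) (extensionality (λ i → eval-subst A τ a (ts i)))

  ⊨ᵃ-subst : ∀ A {m n} (τ : Fin m → Term n) a α →
             (A ⊨ᵃ substᵃ τ α [ a ]) ≡ (A ⊨ᵃ α [ (λ i → eval A a (τ i)) ])
  ⊨ᵃ-subst A τ a falsity    = refl
  ⊨ᵃ-subst A τ a (s ≐ᵗ t)   = cong₂ (Structure._≈_ A) (eval-subst A τ a s) (eval-subst A τ a t)
  ⊨ᵃ-subst A τ a (rel R ts) =
    cong (Structure.⟦rel⟧ A R) (extensionality (λ i → eval-subst A τ a (ts i)))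

  -- An equality of types makes the quantifier case a congruence and can be transported in both
  -- directions.
  ⊨-rename : ∀ A {m n} (ρ : Fin m → Fin n) a φ → (A ⊨ rename ρ φ [ a ]) ≡ (A ⊨ φ [ a ∘ ρ ])
  ⊨-rename A ρ a (atom α)   = ⊨ᵃ-subst A (var ∘ ρ) a α
  ⊨-rename A ρ a (φ ∧ ψ)    = cong₂ _×_ (⊨-rename A ρ a φ) (⊨-rename A ρ a ψ)
  ⊨-rename A ρ a (φ ∨ ψ)    = cong₂ _⊎_ (⊨-rename A ρ a φ) (⊨-rename A ρ a ψ)
  ⊨-rename A ρ a (exists φ) = cong ∃ (extensionality λ x →
    trans (⊨-rename A (zero ∷ (suc ∘ ρ)) (x ∷ a) φ)
          (cong (λ b → A ⊨ φ [ b ]) (∷-map (x ∷ a) zero (suc ∘ ρ))))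

  ⊨-resp : ∀ A {n} (φ : Formula n) {a b} → a ≡ b → A ⊨ φ [ a ] → A ⊨ φ [ b ]
  ⊨-resp A φ refl p = p

  ∃* : ∀ m {n} → Formula (m + n) → Formula n
  ∃* zero    φ = φ
  ∃* (suc m) φ = ∃* m (exists φ)

  ∃*-intro : ∀ A m {n} (φ : Formula (m + n)) {a} (y : Vector (Carrier A) m) →
             A ⊨ φ [ y ++ a ] → A ⊨ ∃* m φ [ a ]
  ∃*-intro A zero    φ y p = p
  ∃*-intro A (suc m) φ {a} y p = ∃*-intro A m (exists φ) (y ∘ suc)
    (y zero , ⊨-resp A φ (trans (cong (_++ a) (sym (∷-head-tail y))) (∷-++ (y zero) (y ∘ suc) a)) p)

  ∃*-elim : ∀ A m {n} (φ : Formula (m + n)) {a} → A ⊨ ∃* m φ [ a ] →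
            ∃[ y ] A ⊨ φ [ _++_ {m = m} y a ]
  ∃*-elim A zero    φ p = [] , p
  ∃*-elim A (suc m) φ {a} p with ∃*-elim A m (exists φ) p
  ... | y , x , q = x ∷ y , ⊨-resp A φ (sym (∷-++ x y a)) q

  -- Positive formulas under setoid equality and homomorphisms.

  eval-cong : ∀ A {n} {a b : Vector (Carrier A) n} → (∀ i → Structure._≈_ A (a i) (b i)) →
              ∀ t → Structure._≈_ A (eval A a t) (eval A b t)
  eval-cong A e (var i)    = e i
  eval-cong A e (fun f ts) = Structure.fun-cong A f (λ i → eval-cong A e (ts i))

  ⊨ᵃ-cong : ∀ A {n} (α : Atomic n) {a b} → (∀ i → Structure._≈_ A (a i) (b i)) →
            A ⊨ᵃ α [ a ] → A ⊨ᵃ α [ b ]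
  ⊨ᵃ-cong A (s ≐ᵗ t)   e p =
    Structure.trans A (Structure.sym A (eval-cong A e s)) (Structure.trans A p (eval-cong A e t))
  ⊨ᵃ-cong A (rel R ts) e p = Structure.rel-resp A R (λ i → eval-cong A e (ts i)) p

  ⊨-cong : ∀ A {n} (φ : Formula n) {a b} → (∀ i → Structure._≈_ A (a i) (b i)) →
           A ⊨ φ [ a ] → A ⊨ φ [ b ]
  ⊨-cong A (atom α)   e p       = ⊨ᵃ-cong A α e p
  ⊨-cong A (φ ∧ ψ)    e (p , q) = ⊨-cong A φ e p , ⊨-cong A ψ e q
  ⊨-cong A (φ ∨ ψ)    e         = Sum.map (⊨-cong A φ e) (⊨-cong A ψ e)
  ⊨-cong A (exists φ) e (x , p) =
    x , ⊨-cong A φ (λ { zero → Structure.refl A ; (suc i) → e i }) p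

  hom-preserves : ∀ {A B} (h : Hom A B) {n} (φ : Formula n) a → A ⊨ φ [ a ] → B ⊨ φ [ map (to h) a ]
  hom-preserves h (atom α)   a p        = preserves h α a p
  hom-preserves h (φ ∧ ψ)    a (p , q)  = hom-preserves h φ a p , hom-preserves h ψ a q
  hom-preserves h (φ ∨ ψ)    a (inj₁ p) = inj₁ (hom-preserves h φ a p)
  hom-preserves h (φ ∨ ψ)    a (inj₂ p) = inj₂ (hom-preserves h ψ a p)
  hom-preserves {B = B} h (exists φ) a (x , p) =
    to h x , ⊨-resp B φ (∷-map (to h) x a) (hom-preserves h φ (x ∷ a) p)

  hom-cong : ∀ {A B} (h : Hom A B) {x y} → Structure._≈_ A x y → Structure._≈_ B (to h x) (to h y)
  hom-cong h {x} {y} = preserves h (var zero ≐ᵗ var (suc zero)) (x ∷ y ∷ [])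

  infixr 9 _∘ʰ_

  _∘ʰ_ : ∀ {A B C} → Hom B C → Hom A B → Hom A C
  g ∘ʰ f = record
    { to        = to g ∘ to f
    ; preserves = λ α a → preserves g α (map (to f) a) ∘ preserves f α a
    }

  -- Induced and generated substructures.

  induced-eval : ∀ M (S : Substructure M) {n} (a : Vector (Carrier (induced M S)) n) t →
                 proj₁ (eval (induced M S) a t) ≡ eval M (map proj₁ a) t
  induced-eval M S a (var i)    = refl
  induced-eval M S a (fun f ts) =
    cong (Structure.⟦fun⟧ M f) (extensionality (λ i → induced-eval M S a (ts i)))

  induced-⊨ᵃ : ∀ M (S : Substructure M) {n} (α : Atomic n) a →
               (induced M S ⊨ᵃ α [ a ]) ≡ (M ⊨ᵃ α [ map proj₁ a ])
  induced-⊨ᵃ M S falsity    a = refl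
  induced-⊨ᵃ M S (s ≐ᵗ t)   a = cong₂ (Structure._≈_ M) (induced-eval M S a s) (induced-eval M S a t)
  induced-⊨ᵃ M S (rel R ts) a =
    cong (Structure.⟦rel⟧ M R) (extensionality (λ i → induced-eval M S a (ts i)))

  induced-⊨ : ∀ M (S : Substructure M) {n} {φ : Formula n} → QuantifierFree φ → ∀ a →
              (induced M S ⊨ φ [ a ]) ≡ (M ⊨ φ [ map proj₁ a ])
  induced-⊨ M S (atom α) a = induced-⊨ᵃ M S α a
  induced-⊨ M S (φ ∧ ψ)  a = cong₂ _×_ (induced-⊨ M S φ a) (induced-⊨ M S ψ a)
  induced-⊨ M S (φ ∨ ψ)  a = cong₂ _⊎_ (induced-⊨ M S φ a) (induced-⊨ M S ψ a)

  inclusion : ∀ M (S : Substructure M) → Hom (induced M S) M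
  inclusion M S = record { to = proj₁ ; preserves = λ α a → subst id (induced-⊨ᵃ M S α a) }

  full : ∀ M → Substructure M
  full M = record
    { Member    = λ _ → ⊤
    ; resp      = λ _ _ → tt
    ; inhabited = Structure.inhabited M , tt
    ; closed    = λ _ _ _ → tt
    }

  ≅-refl : ∀ {A} → A ≅ A
  ≅-refl {A} = record
    { forth      = idʰ
    ; back       = idʰ
    ; back-forth = λ _ → Structure.refl A
    ; forth-back = λ _ → Structure.refl A
    }
    where
    idʰ : Hom A A
    idʰ = record { to = λ x → x ; preserves = λ _ _ p → p }

  ≅-full : ∀ M → M ≅ induced M (full M)
  ≅-full M = record
    { forth      = record
      { to        = λ x → x , tt
      ; preserves = λ α a → subst id (sym (induced-⊨ᵃ M (full M) α (λ i → a i , tt)))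
      }
    ; back       = inclusion M (full M)
    ; back-forth = λ _ → Structure.refl M
    ; forth-back = λ _ → Structure.refl M
    }

  generated : ∀ A {n} → Vector (Carrier A) (suc n) → Substructure A
  generated A {n} a = record
    { Member    = λ x → ∃[ t ] Structure._≈_ A (eval A a t) x
    ; resp      = λ e (t , e′) → t , Structure.trans A e′ e
    ; inhabited = a zero , var zero , Structure.refl A
    ; closed    = λ f _ m → fun f (proj₁ ∘ m) , Structure.fun-cong A f (proj₂ ∘ m)
    }

  -- Each element carries a term for it, which is evaluated at `b`. Substituting these terms turns
  -- an atomic fact about elements into one about `a`; for equations this is independence of the
  -- chosen term.
  fromGenerated : ∀ A B {n} (a : Vector (Carrier A) (suc n)) (b : Vector (Carrier B) (suc n)) →
                  D A a ⊆ D B b → Hom (induced A (generated A a)) B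
  fromGenerated A B a b D⊆ = record
    { to        = λ (_ , t , _) → eval B b t
    ; preserves = λ α c p →
        let τ = λ i → proj₁ (proj₂ (c i))
            q = ⊨ᵃ-cong A α (λ i → Structure.sym A (proj₂ (proj₂ (c i))))
                  (subst id (induced-⊨ᵃ A (generated A a) α c) p)
            (_ , r) = D⊆ (atom (substᵃ τ α) , subst id (sym (⊨ᵃ-subst A τ a α)) q)
        in subst id (⊨ᵃ-subst B τ b α) r
    }

  -- Sentences with parameters, in place of a language expanded by constants.

  record Sentence (X : Set ℓ) : Set ℓ where
    constructor _⟪_⟫
    field
      {arity} : ℕ
      formula : Formula arity
      params  : Vector X arity

  open Sentence

  _≐ˢ_ : ∀ {X} → X → X → Sentence X
  x ≐ˢ y = atom (var zero ≐ᵗ var (suc zero)) ⟪ x ∷ y ∷ [] ⟫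

  Holds : ∀ {X} A → (X → Carrier A) → Pred (Sentence X) ℓ
  Holds A u s = A ⊨ formula s [ map u (params s) ]

  _∘ˢ_ : ∀ {X Y} → (X → Y) → Sentence X → Sentence Y
  u ∘ˢ (φ ⟪ c ⟫) = φ ⟪ map u c ⟫

  _∧ˢ_ : ∀ {X} → Sentence X → Sentence X → Sentence X
  (φ ⟪ c ⟫) ∧ˢ (ψ ⟪ d ⟫) = (rename (_↑ˡ _) φ ∧ rename (_ ↑ʳ_) ψ) ⟪ c ++ d ⟫

  ∧ˢ-elim : ∀ {X} A (u : X → Carrier A) s t → Holds A u (s ∧ˢ t) → Holds A u s × Holds A u t
  ∧ˢ-elim A u (φ ⟪ c ⟫) (ψ ⟪ d ⟫) (p , q) =
      ⊨-resp A φ (cong (map u) (++-↑ˡ c d)) (subst id (⊨-rename A (_↑ˡ _) _ φ) p)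
    , ⊨-resp A ψ (cong (map u) (++-↑ʳ c d)) (subst id (⊨-rename A (_ ↑ʳ_) _ ψ) q)

  ∧ˢ-intro : ∀ {X} A (u : X → Carrier A) s t → Holds A u s → Holds A u t → Holds A u (s ∧ˢ t)
  ∧ˢ-intro A u (φ ⟪ c ⟫) (ψ ⟪ d ⟫) p q =
      subst id (sym (⊨-rename A (_↑ˡ _) _ φ)) (⊨-resp A φ (cong (map u) (sym (++-↑ˡ c d))) p)
    , subst id (sym (⊨-rename A (_ ↑ʳ_) _ ψ)) (⊨-resp A ψ (cong (map u) (sym (++-↑ʳ c d))) q)

  Holds-cong : ∀ {X} A {u w : X → Carrier A} → (∀ x → u x ≡ w x) → ∀ s → Holds A u s → Holds A w s
  Holds-cong A e s = ⊨-resp A (formula s) (extensionality (e ∘ params s))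

  -- The elements of B occurring in s are existentially quantified, those of
  -- M are kept as parameters.
  module Transfer (M : Structure) (S : Substructure M) (B : Structure) (f : Hom (induced M S) B)
    (tp-reflects : ∀ {n} (a : Vector (Carrier (induced M S)) (suc n)) φ →
                   B ⊨ φ [ map (to f) a ] → M ⊨ φ [ map proj₁ a ]) where

    transfer : (s : Sentence (Carrier (induced M S) ⊎ Carrier B)) → Holds B [ to f , id ] s →
               Σ[ y ∈ (Carrier B → Carrier M) ] Holds M [ proj₁ , y ] s
    transfer (_⟪_⟫ {m} θ c) h =
      let (y , q) = ∃*-elim M (suc m) (rename ρ θ)
                      (tp-reflects xs (∃* (suc m) (rename ρ θ)) (∃*-intro B (suc m) (rename ρ θ) ys
                        (subst id (sym (⊨-rename B ρ _ θ)) (⊨-resp B θ (extensionality back) h))))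
      in y ∘ find , ⊨-resp M θ (extensionality (forth y)) (subst id (⊨-rename M ρ _ θ) q)
      where
      a₀ : Carrier (induced M S)
      a₀ = Structure.inhabited (induced M S)
      -- The leading `a₀` keeps the tuple nonempty, as `tp-reflects` demands, even when `m` is zero;
      -- `a₀` also fills the places of parameters from `B`.
      xs : Vector (Carrier (induced M S)) (suc m)
      xs = a₀ ∷ ([ id , (λ _ → a₀) ] ∘ c)
      ys : Vector (Carrier B) (suc m)
      ys = to f a₀ ∷ ([ to f , id ] ∘ c)
      -- All occurrences of `b` in `c` share one quantified variable, so the solution in `M` is a
      -- function on `B`. Elements that do not occur go to the padding position zero.
      find : Carrier B → Fin (suc m)
      find b = choose (excludedMiddle {P = ∃[ i ] c i ≡ inj₂ b}) (suc ∘ proj₁) zero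
      ys-find : ∀ {i b} → c i ≡ inj₂ b → ys (find b) ≡ b
      ys-find {i} {b} e with excludedMiddle {P = ∃[ i ] c i ≡ inj₂ b}
      ... | yes (_ , e′) = cong [ to f , id ] e′
      ... | no none      = ⊥-elim (none (i , e))
      ρ : Fin m → Fin (suc m + suc m)
      ρ i = [ (λ _ → suc m ↑ʳ suc i) , (λ b → find b ↑ˡ suc m) ] (c i)
      back : ∀ i → [ to f , id ] (c i) ≡ (ys ++ map (to f) xs) (ρ i)
      back i with c i in e
      ... | inj₁ a = sym (trans (lookup-++ʳ ys (map (to f) xs) (suc i))
                      (cong (to f ∘ [ id , (λ _ → a₀) ]) e))
      ... | inj₂ b = sym (trans (lookup-++ˡ ys (map (to f) xs) (find b)) (ys-find e))
      forth : ∀ y i → (y ++ map proj₁ xs) (ρ i) ≡ [ proj₁ , y ∘ find ] (c i)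
      forth y i with c i in e
      ... | inj₁ a = trans (lookup-++ʳ y (map proj₁ xs) (suc i))
                      (cong (proj₁ ∘ [ id , (λ _ → a₀) ]) e)
      ... | inj₂ b = lookup-++ˡ y (map proj₁ xs) (find b)

  -- Compactness with pc models, by Henkin names.

  module _ (𝕋 : HInductiveTheory) where

    -- Naming the elements of a pc model by Henkin constants and taking a
    -- maximal set of sentences satisfiable in models of T gives compactness
    -- and positive closedness at once.
    module Compactness {X : Set ℓ} (F : Pred (Sentence X) ℓ)
      (satisfiable : ∀ Γ → All F Γ →
        ∃[ N ] IsModel 𝕋 N × (Σ[ u ∈ (X → Carrier N) ] All (Holds N u) Γ)) where

      -- The tuple `d` may itself contain witnesses, so one inductive type replaces the usual
      -- infinite chain of language extensions.
      data Name : Set ℓ where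
        old : X → Name
        wit : ∀ {n} → Formula (suc n) → Vector Name n → Name

      -- The names that denote what they are meant to: without this
      -- restriction a maximal set could let wit θ d satisfy something that
      -- forces θ(x,d) to have no solution.
      Legit : ∀ N → (Name → Carrier N) → Pred Name ℓ
      Legit N v (old x)   = ⊤
      Legit N v (wit θ d) = (∀ i → Legit N v (d i)) × N ⊨ exists θ [ map v d ]

      record Point : Set (lsuc ℓ) where
        field
          N       : Structure
          isModel : IsModel 𝕋 N
          v       : Name → Carrier N
          henkin  : ∀ {n} (θ : Formula (suc n)) d → Legit N v (wit θ d) →
                    N ⊨ θ [ v (wit θ d) ∷ map v d ]

      open Point

      LegitAt : Point → Pred Name ℓ
      LegitAt p = Legit (N p) (v p)

      infix 4 _⊩_

      _⊩_ : Point → Pred (Sentence Name) ℓ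
      p ⊩ s = (∀ i → LegitAt p (params s i)) × Holds (N p) (v p) s

      Con : Pred (List (Sentence Name)) (lsuc ℓ)
      Con Γ = ∃[ p ] All (p ⊩_) Γ

      -- A point must interpret every name, but usually only a partial assignment `g` is given. A
      -- witness outside `P` receives a solution of its formula whenever one exists. Excluded middle
      -- may return another proof of `P c` than the one at hand, whence `irr`.
      module Extend (N : Structure) (P : Pred Name ℓ) (irr : ∀ {c} (p q : P c) → p ≡ q)
        (g : ∀ c → P c → Carrier N) where

        extend : Name → Carrier N
        extend (old x)   = choose excludedMiddle (g (old x)) (Structure.inhabited N)
        extend (wit θ d) = choose excludedMiddle (g (wit θ d))
          (choose (excludedMiddle {P = N ⊨ exists θ [ (λ i → extend (d i)) ]}) proj₁
            (Structure.inhabited N))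

        choose-g : ∀ {c} (d : Dec (P c)) {b} (p : P c) → choose d (g c) b ≡ g c p
        choose-g (yes q) p = cong (g _) (irr q p)
        choose-g (no ¬p) p = ⊥-elim (¬p p)

        extend-P : ∀ c (p : P c) → extend c ≡ g c p
        extend-P (old x)   p = choose-g excludedMiddle p
        extend-P (wit θ d) p = choose-g excludedMiddle p

        extend-henkin :
          (∀ {n} (θ : Formula (suc n)) d (p : P (wit θ d)) → N ⊨ θ [ g _ p ∷ map extend d ]) →
          ∀ {n} (θ : Formula (suc n)) d → Legit N extend (wit θ d) →
          N ⊨ θ [ extend (wit θ d) ∷ map extend d ]
        extend-henkin gθ θ d (_ , w) with excludedMiddle {P = P (wit θ d)}
        ... | yes p = gθ θ d p
        ... | no _ with excludedMiddle {P = N ⊨ exists θ [ map extend d ]}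
        ...   | yes (_ , q) = q
        ...   | no ¬w       = ⊥-elim (¬w w)

        point : IsModel 𝕋 N →
          (∀ {n} (θ : Formula (suc n)) d (p : P (wit θ d)) → N ⊨ θ [ g _ p ∷ map extend d ]) → Point
        point m gθ = record { N = N ; isModel = m ; v = extend ; henkin = extend-henkin gθ }

      Base : Pred (Sentence Name) ℓ
      Base s = ∃[ t ] F t × s ≡ old ∘ˢ t

      preimages : ∀ {Γ} → All Base Γ → ∃[ Δ ] All F Δ × Γ ≡ List.map (old ∘ˢ_) Δ
      preimages All.[]                     = List.[] , All.[] , refl
      preimages ((t , f , refl) All.∷ γ) with preimages γ
      ... | Δ , δ , refl = t List.∷ Δ , f All.∷ δ , refl

      base-consistent : ∀ Γ → All Base Γ → Con Γ
      base-consistent Γ γ with preimages γ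
      ... | Δ , δ , refl with satisfiable Δ δ
      ...   | N , m , u , hs = point m (λ _ _ ()) , map⁺ (All.map (λ {t} → transfer t) hs)
        where
        Old : Pred Name ℓ
        Old (old _)   = ⊤
        Old (wit _ _) = ⊥
        irr : ∀ {c} (p q : Old c) → p ≡ q
        irr {old _} _ _ = refl
        value : ∀ c → Old c → Carrier N
        value (old x) _ = u x
        open Extend N Old irr value
        transfer : ∀ t → Holds N u t → point m (λ _ _ ()) ⊩ (old ∘ˢ t)
        transfer (φ ⟪ c ⟫) h =
          (λ _ → tt) , ⊨-resp N φ (extensionality (λ i → sym (extend-P (old (c i)) tt))) h

      open TeichmüllerTukey Con Base (λ sub (p , δ) → p , anti-mono sub δ) base-consistent
        using (teichmüllerTukey)

      -- `Con` lives one universe above `ℓ`, but the maximal set is Boolean; lifted to level `ℓ`, it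
      -- can supply the equality and the relations of a `Structure`.
      Φ : Pred (Sentence Name) ℓ
      Φ s = Lift ℓ (T (proj₁ teichmüllerTukey s))

      Φ-irrelevant : ∀ {s} (p q : Φ s) → p ≡ q
      Φ-irrelevant (lift p) (lift q) = cong lift (T-irrelevant p q)

      Φ-base : ∀ {t} → F t → Φ (old ∘ˢ t)
      Φ-base f = lift (proj₁ (proj₂ teichmüllerTukey) (_ , f , refl))

      Φ-consistent : ∀ Γ → All Φ Γ → Con Γ
      Φ-consistent Γ γ = proj₁ (proj₂ (proj₂ teichmüllerTukey)) Γ (All.map lower γ)

      Φ-maximal : ∀ s → (∀ Γ → All Φ Γ → Con (s List.∷ Γ)) → Φ s
      Φ-maximal s con =
        lift (proj₂ (proj₂ (proj₂ teichmüllerTukey)) s (λ Γ γ → con Γ (All.map lift γ)))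

      -- A point satisfying `Γ` together with any finite part `Δ` of `Φ` also satisfies `s`, so
      -- maximality admits `s`.
      deduce : ∀ {Γ s} → All Φ Γ → (∀ p → All (p ⊩_) Γ → p ⊩ s) → Φ s
      deduce {Γ} {s} γ imp = Φ-maximal s λ Δ δ →
        let (p , h) = Φ-consistent (Γ List.++ Δ) (++⁺ γ δ)
        in p , imp p (++⁻ˡ Γ h) All.∷ ++⁻ʳ Γ h

      -- The substitute for negation: by maximality, an omitted sentence has a finite obstruction
      -- inside `Φ`.
      refuting : ∀ s → ¬ Φ s → ∃[ Γ ] All Φ Γ × (∀ p → All (p ⊩_) Γ → ¬ p ⊩ s)
      refuting s s∉Φ = byContradiction λ none → s∉Φ (Φ-maximal s λ Γ γ →
        byContradiction λ ¬con → none (Γ , γ , λ p h q → ¬con (p , q All.∷ h)))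

      -- Forcing a sentence includes legitimacy of its names, so the trivial equation says exactly
      -- that `c` is legitimate.
      Denotes : Pred Name ℓ
      Denotes c = Φ (c ≐ˢ c)

      ⊩-refl : ∀ p {c} → LegitAt p c → p ⊩ c ≐ˢ c
      ⊩-refl p l = (λ { zero → l ; (suc zero) → l }) , Structure.refl (N p)

      params-denote : ∀ {s} → Φ s → ∀ i → Denotes (params s i)
      params-denote σ i = deduce (σ All.∷ All.[]) λ { p ((l , _) All.∷ _) → ⊩-refl p (l i) }

      -- The Henkin structure on the names that denote.

      Element : Set ℓ
      Element = ∃ Denotes

      names : ∀ {n} → Vector Element n → Vector Name n
      names = map proj₁

      -- A conclusion may mention names that do not occur in `Γ`; their denotation sentences join
      -- the premises to make them legitimate.
      deduceFor : ∀ {n} (c : Vector Element n) {Γ s} → All Φ Γ →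
        (∀ p → (∀ i → LegitAt p (names c i)) → All (p ⊩_) Γ → p ⊩ s) → Φ s
      deduceFor c {Γ} γ imp = deduce
        (++⁺ (tabulate⁺ (λ i → proj₂ (c i))) γ)
        (λ p h → imp p (λ i → proj₁ (tabulate⁻ (++⁻ˡ (List.tabulate _) h) i) zero)
                       (++⁻ʳ (List.tabulate _) h))

      -- Names are not closed under function symbols; the value of `f` is named by the witness for
      -- its graph.
      graph : ∀ f → Formula (suc (funArity f))
      graph f = atom (var zero ≐ᵗ fun f (var ∘ suc))

      graph-legit : ∀ p f {c} → (∀ i → LegitAt p (c i)) → LegitAt p (wit (graph f) c)
      graph-legit p f l = l , _ , Structure.refl (N p)

      graph-value : ∀ p f {c} → (∀ i → LegitAt p (c i)) →
        Structure._≈_ (N p) (v p (wit (graph f) c)) (Structure.⟦fun⟧ (N p) f (map (v p) c))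
      graph-value p f {c} l = henkin p (graph f) c (graph-legit p f l)

      infix 4 _≈ᴱ_

      _≈ᴱ_ : Element → Element → Set ℓ
      (a , _) ≈ᴱ (b , _) = Φ (a ≐ˢ b)

      -- `X` may be empty, so the element is the witness of a valid formula without parameters.
      E-inhabited : Element
      E-inhabited = wit (atom (var zero ≐ᵗ var zero)) [] , deduce All.[]
        (λ p _ → ⊩-refl p ((λ ()) , Structure.inhabited (N p) , Structure.refl (N p)))

      E : Structure
      E = record
        { setoid = record
          { Carrier = Element
          ; _≈_     = _≈ᴱ_
          ; isEquivalence = record
            { refl  = λ {(_ , δ)} → δ
            ; sym   = λ e → deduce (e All.∷ All.[]) λ { p ((l , h) All.∷ _) →
                (λ { zero → l (suc zero) ; (suc zero) → l zero }) , Structure.sym (N p) h }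
            ; trans = λ e e′ → deduce (e All.∷ e′ All.∷ All.[]) λ { p ((l , h) All.∷ (l′ , h′) All.∷ _) →
                (λ { zero → l zero ; (suc zero) → l′ (suc zero) }) , Structure.trans (N p) h h′ }
            }
          }
        ; inhabited = E-inhabited
        ; ⟦fun⟧     = λ f c → wit (graph f) (names c) ,
            deduceFor c All.[] (λ p l _ → ⊩-refl p (graph-legit p f l))
        ; ⟦rel⟧     = λ R c → Φ (atom (rel R var) ⟪ names c ⟫)
        ; fun-cong  = λ f {a} {b} e → deduceFor a {List.tabulate (λ i → names a i ≐ˢ names b i)} (tabulate⁺ e)
            λ p l h → let la = λ i → proj₁ (tabulate⁻ h i) zero
                          lb = λ i → proj₁ (tabulate⁻ h i) (suc zero)
                      in (λ { zero → graph-legit p f la ; (suc zero) → graph-legit p f lb }) ,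
                         Structure.trans (N p) (graph-value p f la)
                           (Structure.trans (N p) (Structure.fun-cong (N p) f (λ i → proj₂ (tabulate⁻ h i)))
                             (Structure.sym (N p) (graph-value p f lb)))
        ; rel-resp  = λ R {a} {b} e r → deduce (r All.∷ tabulate⁺ e)
            λ { p ((l , q) All.∷ h) → (λ i → proj₁ (tabulate⁻ h i) (suc zero)) ,
                  Structure.rel-resp (N p) R (λ i → proj₂ (tabulate⁻ h i)) q }
        }

      eval-names : ∀ p {n} (c : Vector Element n) → (∀ i → LegitAt p (names c i)) → ∀ t →
        LegitAt p (proj₁ (eval E c t)) ×
        Structure._≈_ (N p) (v p (proj₁ (eval E c t))) (eval (N p) (map (v p) (names c)) t)
      eval-names p c l (var i)    = l i , Structure.refl (N p)
      eval-names p c l (fun f ts) =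
          graph-legit p f (λ i → proj₁ (eval-names p c l (ts i)))
        , Structure.trans (N p) (graph-value p f (λ i → proj₁ (eval-names p c l (ts i))))
            (Structure.fun-cong (N p) f (λ i → proj₂ (eval-names p c l (ts i))))

      -- If both disjuncts were omitted, a point satisfying the disjunction and both finite
      -- obstructions would contradict one of them.
      Φ-∨ : ∀ {n} {φ ψ : Formula n} {c} → Φ ((φ ∨ ψ) ⟪ c ⟫) → Φ (φ ⟪ c ⟫) ⊎ Φ (ψ ⟪ c ⟫)
      Φ-∨ {φ = φ} {ψ} {c} d = byContradiction λ neither →
        let (Γ , γ , ¬φ) = refuting (φ ⟪ c ⟫) (neither ∘ inj₁)
            (Δ , δ , ¬ψ) = refuting (ψ ⟪ c ⟫) (neither ∘ inj₂)
        in absurd Γ ¬φ ¬ψ (Φ-consistent _ (d All.∷ ++⁺ γ δ))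
        where
        absurd : ∀ Γ {Δ} → (∀ p → All (p ⊩_) Γ → ¬ p ⊩ φ ⟪ c ⟫) → (∀ p → All (p ⊩_) Δ → ¬ p ⊩ ψ ⟪ c ⟫) →
                 ¬ Con ((φ ∨ ψ) ⟪ c ⟫ List.∷ (Γ List.++ Δ))
        absurd Γ ¬φ ¬ψ (p , (l , inj₁ q) All.∷ h) = ¬φ p (++⁻ˡ Γ h) (l , q)
        absurd Γ ¬φ ¬ψ (p , (l , inj₂ q) All.∷ h) = ¬ψ p (++⁻ʳ Γ h) (l , q)

      -- The truth lemma.

      truthᵃ⁺ : ∀ {n} (α : Atomic n) c → E ⊨ᵃ α [ c ] → Φ (atom α ⟪ names c ⟫)
      truthᵃ⁺ (s ≐ᵗ t)   c e = deduceFor c (e All.∷ All.[]) λ { p l ((_ , h) All.∷ _) →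
        l , Structure.trans (N p) (Structure.sym (N p) (proj₂ (eval-names p c l s)))
              (Structure.trans (N p) h (proj₂ (eval-names p c l t))) }
      truthᵃ⁺ (rel R ts) c r = deduceFor c (r All.∷ All.[]) λ { p l ((_ , h) All.∷ _) →
        l , Structure.rel-resp (N p) R (λ i → proj₂ (eval-names p c l (ts i))) h }

      truthᵃ⁻ : ∀ {n} (α : Atomic n) c → Φ (atom α ⟪ names c ⟫) → E ⊨ᵃ α [ c ]
      truthᵃ⁻ falsity    c σ with Φ-consistent _ (σ All.∷ All.[])
      ... | _ , (_ , ()) All.∷ _
      truthᵃ⁻ (s ≐ᵗ t)   c σ = deduce (σ All.∷ All.[]) λ { p ((l , h) All.∷ _) →
        (λ { zero → proj₁ (eval-names p c l s) ; (suc zero) → proj₁ (eval-names p c l t) }) ,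
        Structure.trans (N p) (proj₂ (eval-names p c l s))
          (Structure.trans (N p) h (Structure.sym (N p) (proj₂ (eval-names p c l t)))) }
      truthᵃ⁻ (rel R ts) c σ = deduce (σ All.∷ All.[]) λ { p ((l , h) All.∷ _) →
        (λ i → proj₁ (eval-names p c l (ts i))) ,
        Structure.rel-resp (N p) R (λ i → Structure.sym (N p) (proj₂ (eval-names p c l (ts i)))) h }

      wit-denotes : ∀ {n} {θ : Formula (suc n)} {d} → Φ (exists θ ⟪ d ⟫) → Denotes (wit θ d)
      wit-denotes σ = deduce (σ All.∷ All.[]) λ { p (h All.∷ _) → ⊩-refl p h }

      wit-instance : ∀ {n} {θ : Formula (suc n)} {d} → Denotes (wit θ d) → Φ (θ ⟪ wit θ d ∷ d ⟫)
      wit-instance {θ = θ} {d} δ = deduce (δ All.∷ All.[]) λ { p ((l , _) All.∷ _) →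
        (λ { zero → l zero ; (suc i) → proj₁ (l zero) i }) ,
        ⊨-resp (N p) θ (sym (∷-map (v p) _ d)) (henkin p θ d (l zero)) }

      truth⁺ : ∀ {n} (φ : Formula n) c → E ⊨ φ [ c ] → Φ (φ ⟪ names c ⟫)
      truth⁺ (atom α)   c h        = truthᵃ⁺ α c h
      truth⁺ (φ ∧ ψ)    c (h , h′) = deduce (truth⁺ φ c h All.∷ truth⁺ ψ c h′ All.∷ All.[])
        λ { p ((l , q) All.∷ (_ , q′) All.∷ _) → l , q , q′ }
      truth⁺ (φ ∨ ψ)    c (inj₁ h) = deduce (truth⁺ φ c h All.∷ All.[]) λ { p ((l , q) All.∷ _) → l , inj₁ q }
      truth⁺ (φ ∨ ψ)    c (inj₂ h) = deduce (truth⁺ ψ c h All.∷ All.[]) λ { p ((l , q) All.∷ _) → l , inj₂ q }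
      truth⁺ (exists φ) c (x , h)  = deduce (truth⁺ φ (x ∷ c) h All.∷ All.[]) λ { p ((l , q) All.∷ _) →
        l ∘ suc , v p (proj₁ x) ,
        ⊨-resp (N p) φ (extensionality λ { zero → refl ; (suc _) → refl }) q }

      truth⁻ : ∀ {n} (φ : Formula n) c → Φ (φ ⟪ names c ⟫) → E ⊨ φ [ c ]
      truth⁻ (atom α)   c σ = truthᵃ⁻ α c σ
      truth⁻ (φ ∧ ψ)    c σ =
          truth⁻ φ c (deduce (σ All.∷ All.[]) λ { p ((l , q , _) All.∷ _) → l , q })
        , truth⁻ ψ c (deduce (σ All.∷ All.[]) λ { p ((l , _ , q) All.∷ _) → l , q })
      truth⁻ (φ ∨ ψ)    c σ = Sum.map (truth⁻ φ c) (truth⁻ ψ c) (Φ-∨ σ)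
      truth⁻ (exists φ) c σ = x ,
        truth⁻ φ (x ∷ c) (subst (λ d → Φ (φ ⟪ d ⟫)) (sym (∷-map proj₁ x c)) (wit-instance (proj₂ x)))
        where
        x : Element
        x = wit φ (names c) , wit-denotes σ

      -- The conclusion of an axiom is positive and holds at every point that satisfies the premise,
      -- so it lies in `Φ`, and the truth lemma realises it in `E`.
      E-isModel : IsModel 𝕋 E
      E-isModel σ σ∈𝕋 = All.tabulate satisfies
        where
        satisfies : ∀ {ι} → ι ∈ˡ σ → Satisfies E ι
        satisfies {ι} ι∈σ x (y , h) =
          let (z , r) = ∃*-elim E #z ψ′ (truth⁻ (∃* #z ψ′) x witnessed)
          in z , ⊨-resp E ψ (++-swap x z) (subst id (⊨-rename E (swap #x #z) (z ++ x) ψ) r)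
          where
          open HInductiveImplication ι
          ψ′ : Formula (#z + #x)
          ψ′ = rename (swap #x #z) ψ
          witnessed : Φ (∃* #z ψ′ ⟪ names x ⟫)
          witnessed = deduceFor x (truth⁺ φ (x ++ y) h All.∷ All.[]) λ { p l ((_ , q) All.∷ _) →
            let f = v p ∘ proj₁
                (z , r) = All.lookup (isModel p σ σ∈𝕋) ι∈σ (map f x)
                            (map f y , ⊨-resp (N p) φ (++-map f x y) q)
            in l , ∃*-intro (N p) #z ψ′ z
                 (subst id (sym (⊨-rename (N p) (swap #x #z) (z ++ map f x) ψ))
                   (⊨-resp (N p) ψ (sym (++-swap (map f x) z)) r)) }

      -- Makes the target of a homomorphism satisfy all of `Φ`: names that denote follow `h`, and
      -- the others are interpreted afresh in `M`.
      module Continuation (M : Structure) (h : Hom E M) where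

        open Extend M Denotes Φ-irrelevant (λ c δ → to h (c , δ)) public

        extend-holds : ∀ {s} → Φ s → Holds M extend s
        extend-holds {s} σ =
          ⊨-resp M (formula s) (extensionality (λ i → sym (extend-P _ (params-denote σ i))))
            (hom-preserves h (formula s) elements (truth⁻ (formula s) elements σ))
          where
          elements : Vector Element (arity s)
          elements i = params s i , params-denote σ i

        wit-holds : ∀ {n} (θ : Formula (suc n)) d (δ : Denotes (wit θ d)) →
          M ⊨ θ [ to h (wit θ d , δ) ∷ map extend d ]
        wit-holds θ d δ = ⊨-resp M θ
          (trans (∷-map extend (wit θ d) d) (cong (_∷ map extend d) (extend-P (wit θ d) δ)))
          (extend-holds (wit-instance δ))

        legit : ∀ c → Denotes c → Legit M extend c
        legit (old x)   δ = tt
        legit (wit θ d) δ = (λ i → legit (d i) (params-denote (wit-instance δ) (suc i))) ,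
          _ , wit-holds θ d δ

      -- If `φ` holds at the image, then `M` is a point that satisfies `φ` along with every finite
      -- part of `Φ`; by maximality `φ` is in `Φ`, hence true in `E`.
      E-isPC : IsPC 𝕋 E
      E-isPC = E-isModel , λ M m h a φ → mk⇔ (hom-preserves h φ a) λ q →
        let open Continuation M h
            p = point m wit-holds
        in truth⁻ φ a (Φ-maximal (φ ⟪ names a ⟫) λ Γ γ → p ,
             ( (λ i → legit _ (proj₂ (a i)))
             , ⊨-resp M φ (extensionality (λ i → sym (extend-P _ (proj₂ (a i))))) q )
             All.∷ All.map (λ σ → (λ i → legit _ (params-denote σ i)) , extend-holds σ) γ)

      old-element : X → Element
      old-element x = old x , deduce All.[] (λ p _ → ⊩-refl p {old x} tt)

      compactness : ∃[ M ] IsPC 𝕋 M × (Σ[ u ∈ (X → Carrier M) ] (∀ s → F s → Holds M u s))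
      compactness = E , E-isPC , old-element , λ s f → truth⁻ (formula s) _ (Φ-base f)


    -- Amalgamation over a substructure.

    module Amalgam {M : Structure} (M-model : IsModel 𝕋 M) (S : Substructure M) (B C : Structure)
      (f : Hom (induced M S) B) (g : Hom (induced M S) C)
      (f-reflects : ∀ {n} (a : Vector (Carrier (induced M S)) (suc n)) φ →
                    B ⊨ φ [ map (to f) a ] → M ⊨ φ [ map proj₁ a ])
      (g-reflects : ∀ {n} (a : Vector (Carrier (induced M S)) (suc n)) φ →
                    C ⊨ φ [ map (to g) a ] → M ⊨ φ [ map proj₁ a ]) where

      A : Structure
      A = induced M S

      X : Set ℓ
      X = Carrier A ⊎ Carrier B ⊎ Carrier C

      valueB : Carrier A ⊎ Carrier B → Carrier B
      valueB = [ to f , id ]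

      valueC : Carrier A ⊎ Carrier C → Carrier C
      valueC = [ to g , id ]

      ιB : Carrier A ⊎ Carrier B → X
      ιB = Sum.map₂ inj₁

      ιC : Carrier A ⊎ Carrier C → X
      ιC = Sum.map₂ inj₂

      -- Sentences may mix elements of `A`, read through `f` or `g`, with those of `B` or `C`. The
      -- equations between an element of `A` and its images thus belong here, and they make the
      -- amalgam commute.
      data Diagram : Pred (Sentence X) ℓ where
        fromB : ∀ s → Holds B valueB s → Diagram (ιB ∘ˢ s)
        fromC : ∀ s → Holds C valueC s → Diagram (ιC ∘ˢ s)

      -- All facts about `B` need one common assignment in `M`, so they are merged into a single
      -- sentence, and likewise for `C`. The two assignments share only elements of `A`, which stay
      -- fixed in `M`.
      conjoin : ∀ {Γ} → All Diagram Γ → ∃[ s ] ∃[ t ] Holds B valueB s × Holds C valueC t ×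
        (∀ N (u : X → Carrier N) → Holds N (u ∘ ιB) s → Holds N (u ∘ ιC) t → All (Holds N u) Γ)
      conjoin All.[] = trivial , trivial , Structure.refl B , Structure.refl C , λ _ _ _ _ → All.[]
        where
        trivial : ∀ {Y : Set ℓ} → Sentence (Carrier A ⊎ Y)
        trivial = inj₁ (Structure.inhabited A) ≐ˢ inj₁ (Structure.inhabited A)
      conjoin (fromB r hr All.∷ δ) with conjoin δ
      ... | s , t , hs , ht , k = r ∧ˢ s , t , ∧ˢ-intro B valueB r s hr hs , ht , λ N u p q →
        let (p₁ , p₂) = ∧ˢ-elim N (u ∘ ιB) r s p in p₁ All.∷ k N u p₂ q
      conjoin (fromC r hr All.∷ δ) with conjoin δ
      ... | s , t , hs , ht , k = s , r ∧ˢ t , hs , ∧ˢ-intro C valueC r t hr ht , λ N u p q →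
        let (q₁ , q₂) = ∧ˢ-elim N (u ∘ ιC) r t q in q₁ All.∷ k N u p q₂

      satisfiable : ∀ Γ → All Diagram Γ →
        ∃[ N ] IsModel 𝕋 N × (Σ[ u ∈ (X → Carrier N) ] All (Holds N u) Γ)
      satisfiable Γ δ =
        let (s , t , hs , ht , k) = conjoin δ
            (y , p) = Transfer.transfer M S B f f-reflects s hs
            (z , q) = Transfer.transfer M S C g g-reflects t ht
            u = [ proj₁ , [ y , z ] ]
        in M , M-model , u ,
           k M u (Holds-cong M {[ proj₁ , y ]} {u ∘ ιB} (λ { (inj₁ _) → refl ; (inj₂ _) → refl }) s p)
                 (Holds-cong M {[ proj₁ , z ]} {u ∘ ιC} (λ { (inj₁ _) → refl ; (inj₂ _) → refl }) t q)

      amalgam : ∃[ N ] IsPC 𝕋 N × (Σ[ β ∈ Hom B N ] Σ[ γ ∈ Hom C N ]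
        (∀ x → Structure._≈_ N (to β (to f x)) (to γ (to g x))))
      amalgam = homs (Compactness.compactness Diagram satisfiable)
        where
        homs : ∃[ N ] IsPC 𝕋 N × (Σ[ u ∈ (X → Carrier N) ] (∀ s → Diagram s → Holds N u s)) → _
        homs (N , N-pc , u , holds) = N , N-pc ,
          record { to        = u ∘ inj₂ ∘ inj₁
                 ; preserves = λ α b p → holds _ (fromB (atom α ⟪ inj₂ ∘ b ⟫) p) } ,
          record { to        = u ∘ inj₂ ∘ inj₂
                 ; preserves = λ α c p → holds _ (fromC (atom α ⟪ inj₂ ∘ c ⟫) p) } ,
          λ x → Structure.trans N
            (Structure.sym N (holds _ (fromB (inj₁ x ≐ˢ inj₂ (to f x)) (Structure.refl B))))
            (holds _ (fromC (inj₁ x ≐ˢ inj₂ (to g x)) (Structure.refl C)))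

    -- The two directions of the equivalence.

    pc-in-class : ∀ {M} → IsPC 𝕋 M → M ∈ SubstructuresOfPCModels 𝕋
    pc-in-class {M} pc = M , pc , full M , ≅-full M

    -- Types are compared between pc models, so `B` and `C` are replaced by pc models around them
    -- and `A` by its copy inside one; the isomorphism with that copy is undone at the end.
    robinson⇒amalgamation : IsPositiveRobinson 𝕋 → HasAmalgamation (SubstructuresOfPCModels 𝕋)
    robinson⇒amalgamation robinson A B C (MA , pcA , SA , A≅) (MB , pcB , SB , B≅)
      (MC , pcC , SC , C≅) f g =
      compose (Amalgam.amalgam (proj₁ pcA) SA MB MC f′ g′ (tp-reflects pcB f′) (tp-reflects pcC g′))
      where
      open _≅_ A≅ using (forth; back; back-forth)
      toMB : Hom B MB
      toMB = inclusion MB SB ∘ʰ _≅_.forth B≅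
      toMC : Hom C MC
      toMC = inclusion MC SC ∘ʰ _≅_.forth C≅
      tp-reflects : ∀ {M} → IsPC 𝕋 M → (h : Hom (induced MA SA) M) →
        ∀ {n} (a : Vector (Carrier (induced MA SA)) (suc n)) φ →
        M ⊨ φ [ map (to h) a ] → MA ⊨ φ [ map proj₁ a ]
      -- Quantifier-free formulas pass from `MA` to its substructure and then along `h`, which is
      -- the inclusion of `D` that the Robinson property asks for.
      tp-reflects {M} pcM h a φ = proj₂ (robinson MA M pcA pcM (map proj₁ a) (map (to h) a)
        λ {ψ} (qf , p) → qf , hom-preserves h ψ a (subst id (sym (induced-⊨ MA SA qf a)) p)) {φ}
      f′ : Hom (induced MA SA) MB
      f′ = toMB ∘ʰ f ∘ʰ back
      g′ : Hom (induced MA SA) MC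
      g′ = toMC ∘ʰ g ∘ʰ back
      compose : ∃[ N ] IsPC 𝕋 N × (Σ[ β ∈ Hom MB N ] Σ[ γ ∈ Hom MC N ]
          (∀ x → Structure._≈_ N (to β (to f′ x)) (to γ (to g′ x)))) →
        Σ[ N ∈ Structure ] (N ∈ SubstructuresOfPCModels 𝕋 × (Σ[ β ∈ Hom B N ] Σ[ γ ∈ Hom C N ]
          (∀ x → Structure._≈_ N (to β (to f x)) (to γ (to g x)))))
      compose (N , N-pc , β , γ , commutes) = N , pc-in-class N-pc , β ∘ʰ toMB , γ ∘ʰ toMC , λ x →
        Structure.trans N (hom-cong (β ∘ʰ toMB ∘ʰ f) (Structure.sym A (back-forth x)))
          (Structure.trans N (commutes (to forth x)) (hom-cong (γ ∘ʰ toMC ∘ʰ g) (back-forth x)))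

    amalgamation⇒robinson : HasAmalgamation (SubstructuresOfPCModels 𝕋) → IsPositiveRobinson 𝕋
    amalgamation⇒robinson amalgamation A B pcA pcB a b D⊆
      with amalgamation (induced A (generated A a)) A B
             (A , pcA , generated A a , ≅-refl) (pc-in-class pcA) (pc-in-class pcB)
             (inclusion A (generated A a)) (fromGenerated A B a b D⊆)
    ... | E , (M , pcM , SM , E≅) , g , f , commutes =
        (λ {φ} p → from (tpB φ) (⊨-cong M φ {map (to (k ∘ʰ g)) a} a≈b (to⇔ (tpA φ) p)))
      , (λ {φ} p → from (tpA φ) (⊨-cong M φ {map (to (k ∘ʰ f)) b}
          (λ i → Structure.sym M (a≈b i)) (to⇔ (tpB φ) p)))
      where
      open Equivalence using (from) renaming (to to to⇔)
      -- `E` is only a substructure of a pc model and may fail to be a model; continuing into `M`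
      -- makes the pc property of `A` and `B` applicable.
      k : Hom E M
      k = inclusion M SM ∘ʰ _≅_.forth E≅
      tpA : ∀ φ → A ⊨ φ [ a ] ⇔ M ⊨ φ [ map (to (k ∘ʰ g)) a ]
      tpA = proj₂ pcA M (proj₁ pcM) (k ∘ʰ g) a
      tpB : ∀ φ → B ⊨ φ [ b ] ⇔ M ⊨ φ [ map (to (k ∘ʰ f)) b ]
      tpB = proj₂ pcB M (proj₁ pcM) (k ∘ʰ f) b
      a≈b : ∀ i → Structure._≈_ M (to k (to g (a i))) (to k (to f (b i)))
      a≈b i = hom-cong k (commutes (a i , var i , Structure.refl A))

lemma6 : ClassicalSetTheory →
    ∀ {ℓ : Level} (L : Language ℓ) (let open PositiveLogic L) (T : HInductiveTheory) →
    IsPositiveRobinson T ⇔ HasAmalgamation (SubstructuresOfPCModels T)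
lemma6 cst L T = mk⇔ (robinson⇒amalgamation T) (amalgamation⇒robinson T)
  where open PositiveModelTheory cst L
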